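{- For any upset $\alpha$ and any argument $\Gamma\rhd\Delta$, if $\Gamma\rhd\Delta$ is classically invalid (i.e. not classically valid), then it is $\alpha$-preservation invalid (i.e. not $\alpha$-preservation valid).
   Context: Language: $\mathcal{L}$ is the propositional language with countably infinitely many atomic sentences and connectives $\neg,\lor$ (other classical connectives defined as usual). An argument $\Gamma\rhd\Delta$ is a pair of finite (possibly empty) sets $\Gamma,\Delta$ of sentences of $\mathcal{L}$. A probabilistic model is $\langle W,\mathcal{A},[\![\cdot]\!],P\rangle$ where $W$ is a nonempty set (of worlds); $\mathcal{A}\subseteq\mathcal{P}(W)$ contains $\emptyset$ and is closed under complement in $W$ and binary union; $[\![\cdot]\!]:\mathcal{L}\to\mathcal{A}$ satisfies $[\![\neg\phi]\!]=W\setminus[\![\phi]\!]$ and $[\![\phi\lor\psi]\!]=[\![\phi]\!]\cup[\![\psi]\!]$; and $P:\mathcal{A}\to[0,1]$ is a finitely additive probability ($P(\emptyset)=0$, $P(W\setminus A)=1-P(A)$, and $P(A\cup B)=P(A)+P(B)$ for disjoint $A,B\in\mathcal{A}$). Write $P(\phi)$ for $P([\![\phi]\!])$. An upset is a set $\alpha\subseteq[0,1]$ with $1\in\alpha$, $0\notin\alpha$, and such that $x\in\alpha$, $x\le y\le 1$ imply $y\in\alpha$. $\Gamma\rhd\Delta$ is $\alpha$-preservation valid iff in every probabilistic model, if $P(\gamma)\in\alpha$ for every $\gamma\in\Gamma$, then $P(\delta)\in\alpha$ for some $\delta\in\Delta$. $\Gamma\rhd\Delta$ is classically valid iff for every probabilistic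 model and every world $w\in W$, if $w\in[\![\gamma]\!]$ for every $\gamma\in\Gamma$, then $w\in[\![\delta]\!]$ for some $\delta\in\Delta$. -}

module Defs where

open import Data.Integer.Base as ℤ using (1ℤ)
import Data.Integer.Solver as ℤSolver
open import Data.List.Base using (List)
open import Data.List.Membership.Propositional using () renaming (_∈_ to _∈ˡ_)
open import Data.Nat.Base as ℕ using (ℕ; suc)
open import Data.Product.Base using (_×_; ∃-syntax; _,_)
open import Data.Rational.Base as ℚ using (ℚ; 0ℚ; 1ℚ; ∣_∣)
import Data.Rational.Properties as ℚₚ
import Data.Rational.Solver as ℚSolver
open import Data.Rational.Unnormalised.Base as ℚᵘ using (mkℚᵘ; *≡*)
import Data.Rational.Unnormalised.Properties as ℚᵘₚ
open import Level using (Level) renaming (suc to lsuc)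
open import Relation.Binary.PropositionalEquality
  using (_≡_; refl; sym; trans; cong; cong₂; subst)
open import Relation.Nullary.Negation.Core using (¬_)
open import Relation.Unary using (Pred; _∈_; _∉_; _≐_; _⊥_; _∪_; ∁)
open import Relation.Unary.Polymorphic using (∅)

-- Real numbers, as Bishop's regular sequences of rationals.

ε : ℕ → ℚ
ε n = 1ℤ ℚ./ suc n

record ℝ : Set where
  constructor mkℝ
  field
    seq     : ℕ → ℚ
    regular : ∀ m n → ∣ seq m ℚ.- seq n ∣ ℚ.≤ ε m ℚ.+ ε n

open ℝ public

infix 4 _≤_ _≈_

-- If x and y have limits x∞ and y∞, then |seq x n - x∞| ≤ ε n and likewise
-- for y, so the slack 2 ε n makes this equivalent to x∞ ≤ y∞.
_≤_ : ℝ → ℝ → Set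
x ≤ y = ∀ n → seq x n ℚ.≤ seq y n ℚ.+ (ε n ℚ.+ ε n)

-- Equality of real numbers; ℝ is used as a setoid under this relation.
_≈_ : ℝ → ℝ → Set
x ≈ y = x ≤ y × y ≤ x

private
  ε-pos : ∀ n → 0ℚ ℚ.≤ ε n
  ε-pos n = ℚₚ.nonNegative⁻¹ (ε n) {{ℚₚ.normalize-nonNeg 1 (suc n)}}

  const-regular : ∀ (q : ℚ) m n → ∣ q ℚ.- q ∣ ℚ.≤ ε m ℚ.+ ε n
  const-regular q m n =
    subst (λ r → ∣ r ∣ ℚ.≤ ε m ℚ.+ ε n) (sym (ℚₚ.+-inverseʳ q))
      (ℚₚ.+-mono-≤ (ε-pos m) (ε-pos n))

  double : ℕ → ℕ
  double n = suc (n ℕ.+ n)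

  ε-double : ∀ n → ε (double n) ℚ.+ ε (double n) ≡ ε n
  ε-double n = ℚₚ.toℚᵘ-injective
    (ℚᵘₚ.≃-trans (ℚₚ.toℚᵘ-homo-+ (ε (double n)) (ε (double n)))
    (ℚᵘₚ.≃-trans (ℚᵘₚ.+-cong (toε (double n)) (toε (double n)))
    (ℚᵘₚ.≃-trans halves (ℚᵘₚ.≃-sym (toε n)))))
    where
    toε : ∀ k → ℚ.toℚᵘ (ε k) ℚᵘ.≃ mkℚᵘ 1ℤ k
    toε k = ℚₚ.toℚᵘ-fromℚᵘ (mkℚᵘ 1ℤ k)

    halves : mkℚᵘ 1ℤ (double n) ℚᵘ.+ mkℚᵘ 1ℤ (double n) ℚᵘ.≃ mkℚᵘ 1ℤ n
    halves = *≡* (solve 1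
      (λ k → let d = con 1ℤ :+ (con 1ℤ :+ (k :+ k)) in
        (con 1ℤ :* d :+ con 1ℤ :* d) :* (con 1ℤ :+ k) := con 1ℤ :* (d :* d))
      refl (ℤ.+ n))
      where open ℤSolver.+-*-Solver

  sum-bound : ∀ {a b} m n →
              ∣ a ∣ ℚ.≤ ε (double m) ℚ.+ ε (double n) →
              ∣ b ∣ ℚ.≤ ε (double m) ℚ.+ ε (double n) →
              ∣ a ℚ.+ b ∣ ℚ.≤ ε m ℚ.+ ε n
  sum-bound {a} {b} m n a≤ b≤ =
    ℚₚ.≤-trans (ℚₚ.∣p+q∣≤∣p∣+∣q∣ a b)
    (ℚₚ.≤-trans (ℚₚ.+-mono-≤ a≤ b≤) (ℚₚ.≤-reflexive
    (trans (swap (ε (double m)) (ε (double n)))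
           (cong₂ ℚ._+_ (ε-double m) (ε-double n)))))
    where
    open ℚSolver.+-*-Solver
    swap : ∀ p q → (p ℚ.+ q) ℚ.+ (p ℚ.+ q) ≡ (p ℚ.+ p) ℚ.+ (q ℚ.+ q)
    swap = solve 2 (λ p q → (p :+ q) :+ (p :+ q) := (p :+ p) :+ (q :+ q)) refl

0ℝ : ℝ
0ℝ = mkℝ (λ _ → 0ℚ) (const-regular 0ℚ)

1ℝ : ℝ
1ℝ = mkℝ (λ _ → 1ℚ) (const-regular 1ℚ)

infixl 6 _+_ _-_
infix  8 -_

_+_ : ℝ → ℝ → ℝ
seq     (x + y) n   = seq x (double n) ℚ.+ seq y (double n)
regular (x + y) m n = subst (λ r → ∣ r ∣ ℚ.≤ ε m ℚ.+ ε n)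
  (regroup (seq x (double m)) (seq x (double n)) (seq y (double m)) (seq y (double n)))
  (sum-bound m n (regular x (double m) (double n)) (regular y (double m) (double n)))
  where
  open ℚSolver.+-*-Solver
  regroup : ∀ a a′ b b′ →
            (a ℚ.- a′) ℚ.+ (b ℚ.- b′) ≡ (a ℚ.+ b) ℚ.- (a′ ℚ.+ b′)
  regroup = solve 4 (λ a a′ b b′ →
    (a :- a′) :+ (b :- b′) := (a :+ b) :- (a′ :+ b′)) refl

-_ : ℝ → ℝ
seq     (- x) n   = ℚ.- seq x n
regular (- x) m n = subst (λ r → r ℚ.≤ ε m ℚ.+ ε n)
  (trans (sym (ℚₚ.∣-p∣≡∣p∣ (seq x m ℚ.- seq x n)))
         (cong ∣_∣ (ℚₚ.neg-distrib-+ (seq x m) (ℚ.- seq x n))))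
  (regular x m n)

_-_ : ℝ → ℝ → ℝ
x - y = x + (- y)

infixr 6 _∨′_
infix  8 ¬′_
infix  4 _▷_

data Sentence : Set where
  atom : ℕ → Sentence
  ¬′_  : Sentence → Sentence
  _∨′_ : Sentence → Sentence → Sentence

-- The finite sets of sentences are given by lists enumerating them; order and
-- repetitions are immaterial, as only membership in the lists is ever used.
record Argument : Set where
  constructor _▷_
  field
    premises    : List Sentence
    conclusions : List Sentence

-- Subsets of W are predicates on W, with extensional equality _≐_.  The fields
-- 𝒜-resp and P-cong say that 𝒜 and P are well defined on subsets taken up
-- to _≐_ (P-cong also makes P independent of the proof of membership in 𝒜).
record Model (ℓ : Level) : Set (lsuc (lsuc ℓ)) where
  field
    W          : Set ℓ
    W-nonempty : W

    𝒜        : Pred (Pred W ℓ) (lsuc ℓ)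
    𝒜-resp   : ∀ {A B} → A ≐ B → A ∈ 𝒜 → B ∈ 𝒜
    ∅-closed : ∅ ∈ 𝒜
    ∁-closed : ∀ {A} → A ∈ 𝒜 → ∁ A ∈ 𝒜
    ∪-closed : ∀ {A B} → A ∈ 𝒜 → B ∈ 𝒜 → (A ∪ B) ∈ 𝒜

    ⟦_⟧  : Sentence → Pred W ℓ
    ⟦_⟧∈𝒜 : ∀ φ → ⟦ φ ⟧ ∈ 𝒜
    ⟦¬⟧ : ∀ φ → ⟦ ¬′ φ ⟧ ≐ ∁ ⟦ φ ⟧
    ⟦∨⟧ : ∀ φ ψ → ⟦ φ ∨′ ψ ⟧ ≐ ⟦ φ ⟧ ∪ ⟦ ψ ⟧

    P      : (A : Pred W ℓ) → A ∈ 𝒜 → ℝ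
    P-cong : ∀ {A B} (a : A ∈ 𝒜) (b : B ∈ 𝒜) → A ≐ B → P A a ≈ P B b
    0≤P    : ∀ {A} (a : A ∈ 𝒜) → 0ℝ ≤ P A a
    P≤1    : ∀ {A} (a : A ∈ 𝒜) → P A a ≤ 1ℝ
    P-∅    : P ∅ ∅-closed ≈ 0ℝ
    P-∁    : ∀ {A} (a : A ∈ 𝒜) → P (∁ A) (∁-closed a) ≈ 1ℝ - P A a
    P-∪    : ∀ {A B} (a : A ∈ 𝒜) (b : B ∈ 𝒜) → A ⊥ B →
             P (A ∪ B) (∪-closed a b) ≈ P A a + P B b

  Pr : Sentence → ℝ
  Pr φ = P ⟦ φ ⟧ ⟦ φ ⟧∈𝒜

-- Invariance of α under _≈_ follows from ⊆[0,1] and up.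
record IsUpset {a} (α : Pred ℝ a) : Set a where
  field
    ⊆[0,1] : ∀ {x} → x ∈ α → 0ℝ ≤ x × x ≤ 1ℝ
    1∈     : 1ℝ ∈ α
    0∉     : 0ℝ ∉ α
    up     : ∀ {x y} → x ∈ α → x ≤ y → y ≤ 1ℝ → y ∈ α

PreservationValid : ∀ {a} (ℓ : Level) → Pred ℝ a → Argument → Set _
PreservationValid ℓ α (Γ ▷ Δ) =
  (M : Model ℓ) → let open Model M in
  (∀ γ → γ ∈ˡ Γ → Pr γ ∈ α) → ∃[ δ ] (δ ∈ˡ Δ × Pr δ ∈ α)

ClassicallyValid : (ℓ : Level) → Argument → Set _
ClassicallyValid ℓ (Γ ▷ Δ) =
  (M : Model ℓ) → let open Model M in
  (w : W) → (∀ γ → γ ∈ˡ Γ → w ∈ ⟦ γ ⟧) → ∃[ δ ] (δ ∈ˡ Δ × w ∈ ⟦ δ ⟧)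

{-# OPTIONS --safe #-}

-- A world w at which all premises and no conclusion hold can be given all the
-- weight: under the point mass at w, true sentences have probability 1 ∈ α and
-- false ones have probability 0 ∉ α.
module Submission where

open import Axiom.ExcludedMiddle using (ExcludedMiddle)
open import Data.Empty using (⊥-elim)
open import Data.Nat.Base using (suc)
open import Data.Product.Base using (_×_; _,_; proj₁)
open import Data.Rational.Base as ℚ using (0ℚ)
import Data.Rational.Properties as ℚₚ
open import Data.Sum.Base using (_⊎_; inj₁; inj₂; [_,_]′)
open import Level using (lower)
open import Relation.Binary.PropositionalEquality
  using (_≡_; refl; sym; subst)
open import Relation.Nullary.Decidable.Core using (Dec; yes; no)
open import Relation.Nullary.Negation.Core using (¬_)
open import Relation.Unary using (Pred; _∈_)
open import Defs

-- The contrapositive is proved. Given a model and a world w where every premise is true, keep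
-- everything but the measure, which becomes the point mass at w. Each sentence then has probability
-- 1 or 0 according to its truth at w, so its probability lies in `α` exactly when it is true at w,
-- and preservation of `α` becomes preservation of truth at w. Excluded middle decides whether w
-- lies in a given set; the probability laws then reduce to finite case checks on `indicator`.

seq-≤⇒≤ : ∀ {x y} → (∀ n → seq x n ℚ.≤ seq y n) → x ≤ y
seq-≤⇒≤ {x} {y} x≤y n = subst (ℚ._≤ seq y n ℚ.+ (ε n ℚ.+ ε n))
  (ℚₚ.+-identityʳ (seq x n))
  (ℚₚ.+-mono-≤ (x≤y n) (ℚₚ.+-mono-≤ 0≤ε 0≤ε))
  where
  0≤ε : 0ℚ ℚ.≤ ε n
  0≤ε = ℚₚ.nonNegative⁻¹ (ε n) {{ℚₚ.normalize-nonNeg 1 (suc n)}}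

-- Enough for the arithmetic below: sums and differences of 0 and 1 are constant sequences that
-- agree termwise by computation.
seq-≡⇒≈ : ∀ {x y} → (∀ n → seq x n ≡ seq y n) → x ≈ y
seq-≡⇒≈ {x} {y} x≡y =
  seq-≤⇒≤ {x} {y} (λ n → ℚₚ.≤-reflexive (x≡y n)) ,
  seq-≤⇒≤ {y} {x} (λ n → ℚₚ.≤-reflexive (sym (x≡y n)))

0≤1 : 0ℝ ≤ 1ℝ
0≤1 = seq-≤⇒≤ {0ℝ} {1ℝ} (λ _ → ℚₚ.nonNegative⁻¹ ℚ.1ℚ)

≤-refl : ∀ {x} → x ≤ x
≤-refl {x} = seq-≤⇒≤ {x} {x} (λ _ → ℚₚ.≤-refl)

module _ {a} {A : Set a} where

  indicator : Dec A → ℝ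
  indicator (yes _) = 1ℝ
  indicator (no  _) = 0ℝ

  0≤indicator : (d : Dec A) → 0ℝ ≤ indicator d
  0≤indicator (yes _) = 0≤1
  0≤indicator (no  _) = ≤-refl {0ℝ}

  indicator≤1 : (d : Dec A) → indicator d ≤ 1ℝ
  indicator≤1 (yes _) = ≤-refl {1ℝ}
  indicator≤1 (no  _) = 0≤1

  indicator-true : A → (d : Dec A) → 1ℝ ≈ indicator d
  indicator-true x (yes _) = seq-≡⇒≈ {1ℝ} {1ℝ} (λ _ → refl)
  indicator-true x (no ¬x) = ⊥-elim (¬x x)

  indicator-false : ¬ A → (d : Dec A) → indicator d ≈ 0ℝ
  indicator-false ¬x (yes x) = ⊥-elim (¬x x)
  indicator-false ¬x (no  _) = seq-≡⇒≈ {0ℝ} {0ℝ} (λ _ → refl)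

-- Used in both directions, this makes the point mass respect extensional equality, although the two
-- sets are decided separately.
indicator-mono : ∀ {a b} {A : Set a} {B : Set b} → (A → B) →
                 (d : Dec A) (e : Dec B) → indicator d ≤ indicator e
indicator-mono f (yes x) e = proj₁ (indicator-true (f x) e)
indicator-mono f (no  _) e = 0≤indicator e

indicator-¬ : ∀ {a} {A : Set a} (d : Dec A) (e : Dec (¬ A)) →
              indicator e ≈ 1ℝ - indicator d
indicator-¬ (yes x) (yes ¬x) = ⊥-elim (¬x x)
indicator-¬ (yes _) (no   _) = seq-≡⇒≈ {0ℝ} {1ℝ - 1ℝ} (λ _ → refl)
indicator-¬ (no  _) (yes  _) = seq-≡⇒≈ {1ℝ} {1ℝ - 0ℝ} (λ _ → refl)
indicator-¬ (no ¬x) (no ¬¬x) = ⊥-elim (¬¬x ¬x)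

indicator-⊎ : ∀ {a b} {A : Set a} {B : Set b} → ¬ (A × B) →
              (d : Dec A) (e : Dec B) (f : Dec (A ⊎ B)) →
              indicator f ≈ indicator d + indicator e
indicator-⊎ ¬xy (yes x) (yes y) _       = ⊥-elim (¬xy (x , y))
indicator-⊎ _   (yes _) (no  _) (yes _) = seq-≡⇒≈ {1ℝ} {1ℝ + 0ℝ} (λ _ → refl)
indicator-⊎ _   (no  _) (yes _) (yes _) = seq-≡⇒≈ {1ℝ} {0ℝ + 1ℝ} (λ _ → refl)
indicator-⊎ _   (no  _) (no  _) (no  _) = seq-≡⇒≈ {0ℝ} {0ℝ + 0ℝ} (λ _ → refl)
indicator-⊎ _   (yes x) (no  _) (no ¬z) = ⊥-elim (¬z (inj₁ x))
indicator-⊎ _   (no  _) (yes y) (no ¬z) = ⊥-elim (¬z (inj₂ y))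
indicator-⊎ _   (no ¬x) (no ¬y) (yes z) = ⊥-elim ([ ¬x , ¬y ]′ z)

-- The interpretation is left untouched, so truth at `w` means the same here as in `M`.
pointMass : ∀ {ℓ} → ExcludedMiddle ℓ → (M : Model ℓ) → Model.W M → Model ℓ
pointMass em M w = record
  { W          = W
  ; W-nonempty = W-nonempty
  ; 𝒜          = 𝒜
  ; 𝒜-resp     = 𝒜-resp
  ; ∅-closed   = ∅-closed
  ; ∁-closed   = ∁-closed
  ; ∪-closed   = ∪-closed
  ; ⟦_⟧        = ⟦_⟧
  ; ⟦_⟧∈𝒜      = ⟦_⟧∈𝒜
  ; ⟦¬⟧        = ⟦¬⟧
  ; ⟦∨⟧        = ⟦∨⟧
  ; P          = λ A _ → indicator (em {A w})
  ; P-cong     = λ _ _ (A⊆B , B⊆A) →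
                   indicator-mono A⊆B em em , indicator-mono B⊆A em em
  ; 0≤P        = λ _ → 0≤indicator em
  ; P≤1        = λ _ → indicator≤1 em
  -- Membership in the polymorphic `∅` is a lifted falsity, which `lower` refutes.
  ; P-∅        = indicator-false lower em
  ; P-∁        = λ _ → indicator-¬ em em
  ; P-∪        = λ _ _ A⊥B → indicator-⊎ A⊥B em em em
  }
  where open Model M

module _ {a} {α : Pred ℝ a} (upset : IsUpset α) where
  open IsUpset upset

  true⇒indicator∈ : ∀ {b} {B : Set b} → B → (d : Dec B) → indicator d ∈ α
  true⇒indicator∈ x d = up 1∈ (proj₁ (indicator-true x d)) (indicator≤1 d)

  indicator∈⇒true : ∀ {b} {B : Set b} (d : Dec B) → indicator d ∈ α → B
  indicator∈⇒true (yes x) _  = x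
  indicator∈⇒true (no  _) 0∈ = ⊥-elim (0∉ 0∈)

  preservationValid⇒classicallyValid :
    ∀ {ℓ} → ExcludedMiddle ℓ → (arg : Argument) →
    PreservationValid ℓ α arg → ClassicallyValid ℓ arg
  preservationValid⇒classicallyValid em (Γ ▷ Δ) valid M w Γ-true
    -- In this model `Pr γ` unfolds to the indicator of `γ` holding at `w`.
    with δ , δ∈Δ , Pδ∈α ← valid (pointMass em M w)
                                (λ γ γ∈Γ → true⇒indicator∈ (Γ-true γ γ∈Γ) em)
    = δ , δ∈Δ , indicator∈⇒true em Pδ∈α

fact19 : ∀ {ℓ a} → ExcludedMiddle ℓ →
    (α : Pred ℝ a) → IsUpset α → (arg : Argument) →
    ¬ ClassicallyValid ℓ arg → ¬ PreservationValid ℓ α arg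
fact19 em α upset arg invalid valid =
  invalid (preservationValid⇒classicallyValid upset em arg valid)
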